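{- Let $G=\langle L,X_u,X_c,(f_l)_{l\in L},\mathit{err}\rangle$ be a symbolic game. Let $e_1,\dots,e_n$ be Boolean functions on $\mathbb{B}^{L,X_u,X_c}$ with $\mathit{err}\equiv\bigvee_{i=1}^n e_i$. Consider the following procedure (Algorithm comp_1): 1. For each $1\le i\le n$, let $w_i=W\big(\langle\mathrm{cone}(e_i),X_u,X_c,(f_l)_{l\in\mathrm{cone}(e_i)}\rangle[\mathit{err}\leftarrow e_i]\big)\uparrow_{L,X_u,X_c}$. 2. Let $\Lambda=\bigwedge_{i=1}^n w_i$. 3. For each $l\in\mathrm{cone}(\Lambda)$, let $f'_l$ be a generalized cofactor of $f_l$ with respect to $\Lambda$. 4. Return $W\big(\langle\mathrm{cone}(\Lambda),X_u,X_c,(f'_l)_{l\in\mathrm{cone}(\Lambda)}\rangle[\mathit{err}\leftarrow\neg\Lambda]\big)\uparrow_{L,X_u,X_c}$. Then the returned set equals $W(G)$, the set of winning valuations of $G$.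
   Context: Let $\mathbb{B}=\{0,1\}$. For a finite set $A$ of Boolean variables, valuations are elements of $\mathbb{B}^A$. Sets of valuations are identified with characteristic functions $\mathbb{B}^A\to\mathbb{B}$, with $\wedge,\vee,\neg$ as intersection, union and complement. $\mathbb{B}^{A,B}=\mathbb{B}^A\times\mathbb{B}^B$. For $A\subseteq B$, $v\downarrow_A$ is the restriction of $v\in\mathbb{B}^B$ to $A$, and $f\uparrow_B(v)=f(v\downarrow_A)$ is the lifting of $f:\mathbb{B}^A\to\mathbb{B}$. Functions not depending on variables outside $A$ are identified with functions on $\mathbb{B}^A$. A symbolic game $G=\langle L,X_u,X_c,(f_l)_{l\in L},\mathit{err}\rangle$ consists of the following data: - finite pairwise disjoint variable sets $L$ (latches), $X_u$ (uncontrollable inputs) and $X_c$ (controllable inputs); - transition functions $f_l:\mathbb{B}^{L,X_u,X_c}\to\mathbb{B}$; - an error function $\mathit{err}:\mathbb{B}^{L,X_u,X_c}\to\mathbb{B}$. $\langle L',X_u,X_c,(g_l)_{l\in L'}\rangle[\mathit{err}\leftarrow e]$ is the game with latches $L'$, transitions $g_l$ and error function $e$, regarded as functions on $\mathbb{B}^{L',X_u,X_c}$. With $\delta(v)(l)=f_l(v)$, an execution from $v$ is a sequence $(v_i)_{i\in\mathbb{N}}$ with $v_0=v$ and $v_{i+1}\downarrow_L=\delta(v_i)$. It is safe if the error function is $0$ on all $v_i$. A strategy $\lambda:\mathbb{B}^{L,X_u}\to\mathbb{B}^{X_c}$ is compatible with an execution if $v_i\downarrow_{X_c}=\lambda(v_i\downarrow_L,v_i\downarrow_{X_u})$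 for all $i\ge0$. A valuation $v$ is winning if some strategy makes all compatible executions from $v$ safe. $W(\cdot)$ denotes the set of winning valuations of a game. Cone of influence: for a Boolean function $\Phi$, let $C$ be the minimal set of variables such that - $C$ contains every $x$ with $(\exists x:\Phi)\not\Leftrightarrow\Phi$, and - for each latch $y\in C$, $C$ contains every variable on which $f_y$ depends. Then $\mathrm{cone}(\Phi)=C\cap L$. A generalized cofactor of $f$ with respect to $g$ is any function $\hat f$ with $\hat f\wedge g=f\wedge g$. -}

module Defs where

open import Data.Bool using (Bool; true; false; not; _∧_; _∨_; if_then_else_)
open import Data.Bool.Properties using (¬-not) renaming (_≟_ to _≟ᵇ_)
open import Data.Empty using (⊥-elim)
open import Data.Fin using (Fin; zero; suc)
open import Data.Fin.Subset using (Subset; inside; outside; ∣_∣)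
open import Data.List using (List; []; _∷_; _++_; map; cartesianProductWith; allFin)
open import Data.List.Membership.Propositional using (lose) renaming (_∈_ to _∈ˡ_)
open import Data.List.Membership.Propositional.Properties using (∈-cartesianProductWith⁺; ∈-map⁺; ∈-++⁺ˡ; ∈-++⁺ʳ; ∈-allFin)
open import Data.List.Relation.Unary.All using (all?) renaming (lookup to lookupᴬ; tabulate to tabulateᴬ)
open import Data.List.Relation.Unary.Any using (any?; here; there; satisfied)
open import Data.Nat using (ℕ; zero; suc; _+_; _≤_; _<_; z≤n; s≤s)
open import Data.Nat.Induction using (Acc; acc; <-wellFounded)
open import Data.Nat.Properties using (m≤n⇒m≤1+n)
open import Data.Product using (Σ; ∃; ∃-syntax; _×_; _,_; proj₁; proj₂)
open import Data.Unit using (⊤; tt)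
open import Data.Vec using (Vec; []; _∷_; lookup; tabulate; _[_]≔_)
open import Data.Vec.Functional using (foldr)
open import Data.Vec.Properties using (≡-dec)
open import Relation.Binary.PropositionalEquality using (_≡_; _≢_; _≗_; refl; sym; trans; cong; subst)
open import Relation.Nullary using (¬_; Dec; yes; no; does)
open import Relation.Nullary.Decidable using (map′; ¬?; _×-dec_)

------------------------------------------------------------------------
-- Valuations and Boolean functions

-- The variable sets L, X_u, X_c are Fin m, Fin u, Fin c; they are disjoint
-- because valuations keep them in separate components.
record Valuation (m u c : ℕ) : Set where
  constructor ⟨_,_,_⟩
  field
    ↓L  : Vec Bool m
    ↓Xu : Vec Bool u
    ↓Xc : Vec Bool c

open Valuation public

BFun : ℕ → ℕ → ℕ → Set
BFun m u c = Valuation m u c → Bool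

data Var (m u c : ℕ) : Set where
  latch : Fin m → Var m u c
  unc   : Fin u → Var m u c
  con   : Fin c → Var m u c

infixl 8 _[_↦_]

_[_↦_] : ∀ {m u c} → Valuation m u c → Var m u c → Bool → Valuation m u c
⟨ l , x , y ⟩ [ latch i ↦ b ] = ⟨ l [ i ]≔ b , x , y ⟩
⟨ l , x , y ⟩ [ unc i   ↦ b ] = ⟨ l , x [ i ]≔ b , y ⟩
⟨ l , x , y ⟩ [ con i   ↦ b ] = ⟨ l , x , y [ i ]≔ b ⟩

∃ᵛ : ∀ {m u c} → Var m u c → BFun m u c → BFun m u c
∃ᵛ x Φ v = Φ (v [ x ↦ false ]) ∨ Φ (v [ x ↦ true ])

DependsOn : ∀ {m u c} → BFun m u c → Var m u c → Set
DependsOn f x = ∃[ v ] f (v [ x ↦ false ]) ≢ f (v [ x ↦ true ])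

⋀ ⋁ : ∀ {m u c n} → (Fin n → BFun m u c) → BFun m u c
⋀ e v = foldr _∧_ true  (λ i → e i v)
⋁ e v = foldr _∨_ false (λ i → e i v)

IsCofactor : ∀ {m u c} → BFun m u c → BFun m u c → BFun m u c → Set
IsCofactor f̂ f g = ∀ v → f̂ v ∧ g v ≡ f v ∧ g v

------------------------------------------------------------------------
-- Restriction to a subset of the latches

-- The increasing enumeration of A; it identifies 𝔹^A with Vec Bool ∣ A ∣.
member : ∀ {m} (A : Subset m) → Fin ∣ A ∣ → Fin m
member (inside  ∷ A) zero    = zero
member (inside  ∷ A) (suc j) = suc (member A j)
member (outside ∷ A) j       = suc (member A j)

_↓_ : ∀ {m} → Vec Bool m → (A : Subset m) → Vec Bool ∣ A ∣
l ↓ A = tabulate (λ j → lookup l (member A j))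

lift : ∀ {m u c} (A : Subset m) → BFun ∣ A ∣ u c → BFun m u c
lift A g ⟨ l , x , y ⟩ = g ⟨ l ↓ A , x , y ⟩

extend : ∀ {m} (A : Subset m) → Vec Bool ∣ A ∣ → Vec Bool m
extend []            []      = []
extend (inside  ∷ A) (b ∷ l) = b ∷ extend A l
extend (outside ∷ A) l       = false ∷ extend A l

-- If f does not depend on latches outside A, this is the function on
-- 𝔹^{A,X_u,X_c} identified with f, i.e. the only g with lift A g ≗ f; the value
-- given by extend to the latches outside A is then immaterial.
narrow : ∀ {m u c} (A : Subset m) → BFun m u c → BFun ∣ A ∣ u c
narrow A f ⟨ l , x , y ⟩ = f ⟨ extend A l , x , y ⟩

------------------------------------------------------------------------
-- Symbolic games

record Game (m u c : ℕ) : Set where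
  field
    f   : Fin m → BFun m u c
    err : BFun m u c

  δ : Valuation m u c → Vec Bool m
  δ v = tabulate (λ l → f l v)

open Game public

-- ⟨ A , X_u , X_c , (g_l)_{l ∈ A} ⟩[ err ← e ]; the g l with l ∉ A are not used.
subgame : ∀ {m u c} (A : Subset m) → (Fin m → BFun m u c) → BFun m u c → Game ∣ A ∣ u c
subgame A g e = record { f = λ j → narrow A (g (member A j)) ; err = narrow A e }

Strategy : ℕ → ℕ → ℕ → Set
Strategy m u c = Vec Bool m × Vec Bool u → Vec Bool c

module _ {m u c : ℕ} (G : Game m u c) where

  IsExecution : Valuation m u c → (ℕ → Valuation m u c) → Set
  IsExecution v ρ = ρ 0 ≡ v × (∀ i → ↓L (ρ (suc i)) ≡ δ G (ρ i))

  IsSafe : (ℕ → Valuation m u c) → Set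
  IsSafe ρ = ∀ i → err G (ρ i) ≡ false

Compatible : ∀ {m u c} → Strategy m u c → (ℕ → Valuation m u c) → Set
Compatible σ ρ = ∀ i → ↓Xc (ρ i) ≡ σ (↓L (ρ i) , ↓Xu (ρ i))

-- Compatibility includes i = 0. A strategy whose choice at (v↓L , v↓X_u) is not
-- v↓X_c is therefore compatible with no execution from v, and then makes all of
-- them safe vacuously: taken to the letter, every v is winning as soon as X_c is
-- nonempty. `literal` is this reading. `proper` also asks that the strategy be
-- compatible with some execution from v, so that the choice v↓X_c made in v
-- counts as the strategy's own.
data Reading : Set where
  literal proper : Reading

Admissible : ∀ {m u c} → Reading → Game m u c → Strategy m u c → Valuation m u c → Set
Admissible literal G σ v = ⊤
Admissible proper  G σ v = ∃[ ρ ] IsExecution G v ρ × Compatible σ ρ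

Winning : ∀ {m u c} → Reading → Game m u c → Valuation m u c → Set
Winning r G v =
  ∃[ σ ] Admissible r G σ v × (∀ ρ → IsExecution G v ρ → Compatible σ ρ → IsSafe G ρ)

-- The minimal set C in the definition of the cone of influence of Φ.
data InCone {m u c : ℕ} (G : Game m u c) (Φ : BFun m u c) : Var m u c → Set where
  base : ∀ {x} → ¬ (∃ᵛ x Φ ≗ Φ) → InCone G Φ x
  step : ∀ {x y} → InCone G Φ (latch y) → DependsOn (f G y) x → InCone G Φ x

------------------------------------------------------------------------
-- Decidability of Winning and InCone, so that both give characteristic functions

Finite : Set → Set
Finite A = Σ (List A) λ xs → ∀ a → a ∈ˡ xs

module _ {A : Set} (fin : Finite A) {P : A → Set} (P? : ∀ a → Dec (P a)) where

  finite-all? : Dec (∀ a → P a)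
  finite-all? = map′ (λ ps a → lookupᴬ ps (proj₂ fin a)) (λ p → tabulateᴬ (λ {a} _ → p a)) (all? P? (proj₁ fin))

  finite-any? : Dec (∃ P)
  finite-any? = map′ satisfied (λ (a , p) → lose (proj₂ fin a) p) (any? P? (proj₁ fin))

vec-finite : ∀ n → Finite (Vec Bool n)
vec-finite zero    = [] ∷ [] , λ { [] → here refl }
vec-finite (suc n) with vec-finite n
... | xs , complete = cartesianProductWith _∷_ (false ∷ true ∷ []) xs ,
  λ { (b ∷ v) → ∈-cartesianProductWith⁺ _∷_ (bool b) (complete v) }
  where
  bool : ∀ b → b ∈ˡ (false ∷ true ∷ [])
  bool false = here refl
  bool true  = there (here refl)

valuation-finite : ∀ m u c → Finite (Valuation m u c)
valuation-finite m u c with vec-finite m | vec-finite u | vec-finite c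
... | ls , l∈ | xs , x∈ | ys , y∈ =
  cartesianProductWith (λ l (x , y) → ⟨ l , x , y ⟩) ls (cartesianProductWith _,_ xs ys) ,
  λ { ⟨ l , x , y ⟩ → ∈-cartesianProductWith⁺ (λ l (x , y) → ⟨ l , x , y ⟩) (l∈ l)
                        (∈-cartesianProductWith⁺ _,_ (x∈ x) (y∈ y)) }

var-finite : ∀ m u c → Finite (Var m u c)
var-finite m u c = ls ++ xs ++ ys , complete
  where
  ls xs ys : List (Var m u c)
  ls = map latch (allFin m)
  xs = map unc (allFin u)
  ys = map con (allFin c)
  complete : ∀ z → z ∈ˡ (ls ++ xs ++ ys)
  complete (latch i) = ∈-++⁺ˡ (∈-map⁺ latch (∈-allFin i))
  complete (unc i)   = ∈-++⁺ʳ ls (∈-++⁺ˡ (∈-map⁺ unc (∈-allFin i)))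
  complete (con i)   = ∈-++⁺ʳ ls (∈-++⁺ʳ xs (∈-map⁺ con (∈-allFin i)))

size : {A : Set} → (A → Bool) → List A → ℕ
size Z []       = 0
size Z (a ∷ as) = (if Z a then 1 else 0) + size Z as

module _ {A : Set} {Y Z : A → Bool} (Y⊆Z : ∀ a → Y a ≡ true → Z a ≡ true) where

  size-mono : ∀ as → size Y as ≤ size Z as
  size-mono []       = z≤n
  size-mono (a ∷ as) with Y a | Z a | Y⊆Z a
  ... | false | false | _ = size-mono as
  ... | false | true  | _ = m≤n⇒m≤1+n (size-mono as)
  ... | true  | true  | _ = s≤s (size-mono as)
  ... | true  | false | h with () ← h refl

  size-strict : ∀ {a} → Z a ≡ true → Y a ≡ false → ∀ {as} → a ∈ˡ as → size Y as < size Z as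
  size-strict p q {a ∷ as} (here refl) rewrite p | q = s≤s (size-mono as)
  size-strict p q {a ∷ as} (there i) with Y a | Z a | Y⊆Z a
  ... | false | false | _ = size-strict p q i
  ... | false | true  | _ = m≤n⇒m≤1+n (size-strict p q i)
  ... | true  | true  | _ = s≤s (size-strict p q i)
  ... | true  | false | h with () ← h refl

-- Iterating a deflationary F on a finite set reaches a fixed point.
module _ {A : Set} (fin : Finite A) (F : (A → Bool) → A → Bool)
         (deflationary : ∀ Z a → F Z a ≡ true → Z a ≡ true)
         (Inv : (A → Bool) → Set) (preserved : ∀ Z → Inv Z → Inv (F Z)) where

  Fixed : Set
  Fixed = ∃[ Z ] Inv Z × (∀ a → Z a ≡ true → F Z a ≡ true)

  private
    iterate : ∀ Z → Inv Z → Acc _<_ (size Z (proj₁ fin)) → Fixed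
    iterate Z inv (acc rec)
      with finite-any? fin {λ a → Z a ≡ true × F Z a ≡ false}
             (λ a → (Z a ≟ᵇ true) ×-dec (F Z a ≟ᵇ false))
    ... | yes (a , p , q) =
      iterate (F Z) (preserved Z inv) (rec (size-strict (deflationary Z) p q (proj₂ fin a)))
    ... | no stable = Z , inv , λ a p → ¬-not (λ q → stable (a , p , q))

  fixedPoint : ∀ Z → Inv Z → Fixed
  fixedPoint Z inv = iterate Z inv (<-wellFounded _)

does-sound : {P : Set} (P? : Dec P) → does P? ≡ true → P
does-sound (yes p) refl = p

does-complete : {P : Set} (P? : Dec P) → P → does P? ≡ true
does-complete (yes _) _ = refl
does-complete (no ¬p) p = ⊥-elim (¬p p)

module _ {m u c : ℕ} (G : Game m u c) where

  private
    V = Valuation m u c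

    next : V → Vec Bool u → Vec Bool c → V
    next v x y = ⟨ δ G v , x , y ⟩

    Good : (V → Bool) → Vec Bool m → Vec Bool u → Set
    Good Z l x = ∃[ y ] Z ⟨ l , x , y ⟩ ≡ true

    good? : ∀ Z l x → Dec (Good Z l x)
    good? Z l x = finite-any? (vec-finite c) (λ y → Z ⟨ l , x , y ⟩ ≟ᵇ true)

    keep? : ∀ Z v → Dec (Z v ≡ true × (∀ x → Good Z (δ G v) x))
    keep? Z v = (Z v ≟ᵇ true) ×-dec finite-all? (vec-finite u) (good? Z (δ G v))

    F : (V → Bool) → V → Bool
    F Z v = does (keep? Z v)

    Inv : (V → Bool) → Set
    Inv Z = (∀ v → Winning proper G v → Z v ≡ true) × (∀ v → Z v ≡ true → err G v ≡ false)

    winning-next : ∀ v → Winning proper G v → ∀ x → ∃[ y ] Winning proper G (next v x y)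
    winning-next v (σ , (ρ , (refl , _) , compat) , win) x = σ (δ G v , x) ,
      σ , (run , (refl , λ _ → refl) , run-compat) ,
      λ ρ′ (start , steps) compat′ i →
        win (v ∷ρ ρ′)
            (refl , λ { zero → cong ↓L start ; (suc j) → steps j })
            (λ { zero → compat 0 ; (suc j) → compat′ j })
            (suc i)
      where
      run : ℕ → V
      run zero    = next v x (σ (δ G v , x))
      run (suc i) = next (run i) x (σ (δ G (run i) , x))
      run-compat : Compatible σ run
      run-compat zero    = refl
      run-compat (suc i) = refl
      _∷ρ_ : V → (ℕ → V) → ℕ → V
      (w ∷ρ ρ′) zero    = w
      (w ∷ρ ρ′) (suc i) = ρ′ i

    preserved : ∀ Z → Inv Z → Inv (F Z)
    preserved Z (wins , safe) =
      (λ v w → does-complete (keep? Z v)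
        (wins v w , λ x → let (y , w′) = winning-next v w x in y , wins _ w′)) ,
      λ v p → safe v (proj₁ (does-sound (keep? Z v) p))

    deflationary : ∀ Z v → F Z v ≡ true → Z v ≡ true
    deflationary Z v p = proj₁ (does-sound (keep? Z v) p)

    region : Fixed (valuation-finite m u c) F deflationary Inv preserved
    region = fixedPoint (valuation-finite m u c) F deflationary Inv preserved (λ v → not (err G v))
      ( (λ v (σ , (ρ , (start , steps) , compat) , win) →
           cong not (trans (cong (err G) (sym start)) (win ρ (start , steps) compat 0)))
      , λ v p → not-true p )
      where
      not-true : ∀ {b} → not b ≡ true → b ≡ false
      not-true {false} _ = refl

    module _ (Z : V → Bool) (safe : ∀ v → Z v ≡ true → err G v ≡ false)
             (closed : ∀ v → Z v ≡ true → ∀ x → Good Z (δ G v) x) (v : V) (v∈Z : Z v ≡ true) where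

      σ : Strategy m u c
      σ (l , x) with ≡-dec _≟ᵇ_ l (↓L v) | ≡-dec _≟ᵇ_ x (↓Xu v) | good? Z l x
      ... | yes _ | yes _ | _           = ↓Xc v
      ... | _     | _     | yes (y , _) = y
      ... | _     | _     | no _        = ↓Xc v

      σ-start : ↓Xc v ≡ σ (↓L v , ↓Xu v)
      σ-start with ≡-dec _≟ᵇ_ (↓L v) (↓L v) | ≡-dec _≟ᵇ_ (↓Xu v) (↓Xu v) | good? Z (↓L v) (↓Xu v)
      ... | yes _ | yes _ | _ = refl
      ... | yes _ | no ¬p | _ = ⊥-elim (¬p refl)
      ... | no ¬p | _     | _ = ⊥-elim (¬p refl)

      σ-good : ∀ l x → Good Z l x → Z ⟨ l , x , σ (l , x) ⟩ ≡ true
      σ-good l x g with ≡-dec _≟ᵇ_ l (↓L v) | ≡-dec _≟ᵇ_ x (↓Xu v) | good? Z l x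
      ... | yes refl | yes refl | _           = v∈Z
      ... | yes _    | no _     | yes (_ , p) = p
      ... | yes _    | no _     | no ¬g       = ⊥-elim (¬g g)
      ... | no _     | yes _    | yes (_ , p) = p
      ... | no _     | yes _    | no ¬g       = ⊥-elim (¬g g)
      ... | no _     | no _     | yes (_ , p) = p
      ... | no _     | no _     | no ¬g       = ⊥-elim (¬g g)

      stays : ∀ ρ → IsExecution G v ρ → Compatible σ ρ → ∀ i → Z (ρ i) ≡ true
      stays ρ (start , _) compat zero = trans (cong Z start) v∈Z
      stays ρ ex@(_ , steps) compat (suc i) =
        trans (cong (λ y → Z ⟨ ↓L (ρ (suc i)) , ↓Xu (ρ (suc i)) , y ⟩) (compat (suc i)))
          (σ-good _ _ (subst (λ l → Good Z l (↓Xu (ρ (suc i)))) (sym (steps i))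
            (closed (ρ i) (stays ρ ex compat i) (↓Xu (ρ (suc i))))))

      winning : Winning proper G v
      winning = σ , (run , (refl , λ _ → refl) , run-compat) ,
                λ ρ ex compat i → safe (ρ i) (stays ρ ex compat i)
        where
        run : ℕ → V
        run zero    = v
        run (suc i) = next (run i) (↓Xu v) (σ (δ G (run i) , ↓Xu v))
        run-compat : Compatible σ run
        run-compat zero    = σ-start
        run-compat (suc i) = refl

  winning-proper? : ∀ v → Dec (Winning proper G v)
  winning-proper? v with region
  ... | Z , (wins , safe) , fixed =
    map′ (winning Z safe (λ w p → proj₂ (does-sound (keep? Z w) (fixed w p))) v) (wins v) (Z v ≟ᵇ true)

winning? : ∀ {m u c} (r : Reading) (G : Game m u c) (v : Valuation m u c) → Dec (Winning r G v)
winning? proper G v = winning-proper? G v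
winning? {c = zero} literal G v =
  map′ (λ (σ , _ , win) → σ , tt , win)
       (λ (σ , _ , win) → σ , (run σ , (refl , λ _ → refl) , λ i → unique _ _) , win)
       (winning-proper? G v)
  where
  unique : (y z : Vec Bool 0) → y ≡ z
  unique [] [] = refl
  run : Strategy _ _ 0 → ℕ → Valuation _ _ 0
  run σ zero    = v
  run σ (suc i) = ⟨ δ G (run σ i) , ↓Xu v , [] ⟩
winning? {c = suc _} literal G ⟨ l , x , b ∷ y ⟩ =
  yes ((λ _ → not b ∷ y) , tt , λ ρ (start , _) compat → ⊥-elim (differ b (ρ 0) start (compat 0)))
  where
  differ : ∀ b w → w ≡ ⟨ l , x , b ∷ y ⟩ → ↓Xc w ≢ not b ∷ y
  differ false _ refl ()
  differ true  _ refl ()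

dependsOn? : ∀ {m u c} (g : BFun m u c) x → Dec (DependsOn g x)
dependsOn? g x =
  finite-any? (valuation-finite _ _ _) (λ v → ¬? (g (v [ x ↦ false ]) ≟ᵇ g (v [ x ↦ true ])))

module _ {m u c : ℕ} (G : Game m u c) (Φ : BFun m u c) where

  private
    -- Z is the set of variables not yet found to be in the cone.
    Leave : (Var m u c → Bool) → Var m u c → Set
    Leave Z x = ∃[ y ] Z (latch y) ≡ false × DependsOn (f G y) x

    base? : ∀ x → Dec (¬ (∃ᵛ x Φ ≗ Φ))
    base? x = ¬? (finite-all? (valuation-finite m u c) (λ v → ∃ᵛ x Φ v ≟ᵇ Φ v))

    leave? : ∀ Z x → Dec (Leave Z x)
    leave? Z x = finite-any? (allFin m , ∈-allFin)
                   (λ y → (Z (latch y) ≟ᵇ false) ×-dec dependsOn? (f G y) x)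

    keep? : ∀ Z x → Dec (Z x ≡ true × ¬ Leave Z x)
    keep? Z x = (Z x ≟ᵇ true) ×-dec ¬? (leave? Z x)

    F : (Var m u c → Bool) → Var m u c → Bool
    F Z x = does (keep? Z x)

    Inv : (Var m u c → Bool) → Set
    Inv Z = (∀ x → Z x ≡ false → InCone G Φ x) × (∀ x → ¬ (∃ᵛ x Φ ≗ Φ) → Z x ≡ false)

    deflationary : ∀ Z x → F Z x ≡ true → Z x ≡ true
    deflationary Z x p = proj₁ (does-sound (keep? Z x) p)

    preserved : ∀ Z → Inv Z → Inv (F Z)
    preserved Z (sound , based) = sound′ ,
      λ x p → ¬-not (λ q → false≢true (trans (sym (based x p)) (deflationary Z x q)))
      where
      false≢true : false ≢ true
      false≢true ()
      sound′ : ∀ x → F Z x ≡ false → InCone G Φ x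
      sound′ x p = by-cases (Z x ≟ᵇ true) (leave? Z x)
        where
        by-cases : Dec (Z x ≡ true) → Dec (Leave Z x) → InCone G Φ x
        by-cases (no q)  _                   = sound x (¬-not q)
        by-cases (yes _) (yes (y , z , dep)) = step (sound (latch y) z) dep
        by-cases (yes q) (no ¬l)             =
          ⊥-elim (false≢true (trans (sym p) (does-complete (keep? Z x) (q , ¬l))))

    start : Var m u c → Bool
    start x = not (does (base? x))

    start-inv : Inv start
    start-inv = (λ x → from (base? x)) , λ x p → cong not (does-complete (base? x) p)
      where
      from : ∀ {x} (d : Dec (¬ (∃ᵛ x Φ ≗ Φ))) → not (does d) ≡ false → InCone G Φ x
      from (yes p) _ = base p

    complete : ∀ Z → Inv Z → (∀ x → Z x ≡ true → F Z x ≡ true) → ∀ {x} → InCone G Φ x → Z x ≡ false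
    complete Z (_ , based) fixed (base p) = based _ p
    complete Z inv fixed {x} (step {y = y} i dep) = ¬-not
      (λ q → proj₂ (does-sound (keep? Z x) (fixed x q)) (y , complete Z inv fixed i , dep))

  inCone? : ∀ x → Dec (InCone G Φ x)
  inCone? x with fixedPoint (var-finite m u c) F deflationary Inv preserved start start-inv
  ... | Z , inv , fixed = map′ (proj₁ inv x) (complete Z inv fixed) (Z x ≟ᵇ false)

------------------------------------------------------------------------
-- The algorithm

W : ∀ {m u c} → Reading → Game m u c → BFun m u c
W r G v = does (winning? r G v)

cone : ∀ {m u c} → Game m u c → BFun m u c → Subset m
cone G Φ = tabulate (λ l → does (inCone? G Φ (latch l)))

module _ {m u c n : ℕ} (r : Reading) (G : Game m u c) (e : Fin n → BFun m u c) where

  w : Fin n → BFun m u c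
  w i = lift (cone G (e i)) (W r (subgame (cone G (e i)) (f G) (e i)))

  Λ : BFun m u c
  Λ = ⋀ w

  comp₁ : (Fin m → BFun m u c) → BFun m u c
  comp₁ f′ = lift (cone G Λ) (W r (subgame (cone G Λ) f′ (λ v → not (Λ v))))

{-# OPTIONS --safe #-}
-- Under the proper reading, W(G) is the largest set of safe valuations from which
-- every uncontrollable input can be answered so as to stay in the set. Hence a
-- relation between latch valuations that is preserved by the transitions at
-- winning valuations, and leads only to safe ones, transports winning.
-- Restriction to a cone is such a relation in both directions. So w_i is the
-- winning set of G with error e_i, and W(G) ⊆ Λ ⊆ ¬err; therefore G and G with
-- error ¬Λ have the same winning set. Cofactors agree with f on Λ, and
-- transitions need to be compared only there.
-- Under the literal reading everything is winning if X_c is nonempty, and the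
-- two readings coincide if it is empty.
module Submission where

open import Defs
open import Data.Bool using (Bool; true; false; not; _∧_; _∨_)
open import Data.Bool.Properties using (∧-identityʳ; not-injective) renaming (_≟_ to _≟ᵇ_)
open import Data.Empty using (⊥-elim)
open import Data.Fin using (Fin; zero; suc)
open import Data.Fin.Subset using (Subset; inside; outside; ∣_∣; _∈_; _∉_)
open import Data.Nat using (ℕ; zero; suc)
open import Data.Product using (∃-syntax; _×_; _,_; proj₁; proj₂)
open import Data.Vec using (Vec; []; _∷_; tabulate; _[_]≔_; here; there)
open import Data.Vec.Properties using (≡-dec; tabulate-cong; lookup∘tabulate; []=⇒lookup; lookup⇒[]=; []≔-idempotent; ∷-injective)
open import Function using (_∘_)
open import Function.Bundles using (_⇔_; mk⇔; module Equivalence)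
open import Relation.Binary.Definitions using (Decidable)
open import Relation.Binary.PropositionalEquality using (_≡_; _≗_; refl; sym; trans; cong; cong₂; subst; module ≡-Reasoning)
open import Relation.Nullary using (Dec; yes; no)
open import Relation.Nullary.Decidable using (_×-dec_; decidable-stable; does-⇔)

private
  variable
    m m′ u c n : ℕ

-- Winning, invariants and simulations.

module _ (G : Game m u c) where

  winning-safe : ∀ {v} → Winning proper G v → err G v ≡ false
  winning-safe (_ , (ρ , ex@(refl , _) , compat) , win) = win ρ ex compat 0

  -- The same strategy keeps winning: an execution from the successor becomes one from `v` when `v`
  -- is put in front. Compatibility at index 0 comes from the witness of admissibility.
  winning-next : ∀ {v} → Winning proper G v → ∀ x → ∃[ y ] Winning proper G ⟨ δ G v , x , y ⟩
  winning-next {v} (σ , (_ , (refl , _) , compat) , win) x =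
    σ (δ G v , x) , σ , (run , (refl , λ _ → refl) , run-compatible) ,
    λ ρ (start , steps) compat′ i →
      win (prepend ρ)
          (refl , λ { zero → cong ↓L start ; (suc j) → steps j })
          (λ { zero → compat 0 ; (suc j) → compat′ j })
          (suc i)
    where
    run : ℕ → Valuation m u c
    run zero    = ⟨ δ G v , x , σ (δ G v , x) ⟩
    run (suc i) = ⟨ δ G (run i) , x , σ (δ G (run i) , x) ⟩

    run-compatible : Compatible σ run
    run-compatible zero    = refl
    run-compatible (suc i) = refl

    prepend : (ℕ → Valuation m u c) → ℕ → Valuation m u c
    prepend ρ zero    = v
    prepend ρ (suc i) = ρ i

module _ (G : Game m u c) {P : Valuation m u c → Set} (P? : ∀ v → Dec (P v))
         (safe : ∀ {v} → P v → err G v ≡ false)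
         (closed : ∀ {v} → P v → ∀ x → ∃[ y ] P ⟨ δ G v , x , y ⟩) where

  -- Away from `v`, the strategy takes any answer that finite search finds to stay in `P`. By
  -- `closed`, compatible executions never meet the arbitrary default.
  invariant⇒winning : ∀ {v} → P v → Winning proper G v
  invariant⇒winning {v} p =
    σ , (run , (refl , λ _ → refl) , run-compatible) ,
    λ ρ ex compat i → safe (stays ρ ex compat i)
    where
    -- The choice must be ↓Xc v at v itself, since v is to be compatible with σ.
    choose : ∀ l x → ∃[ y ] ((∃[ z ] P ⟨ l , x , z ⟩) → P ⟨ l , x , y ⟩)
                          × (l ≡ ↓L v × x ≡ ↓Xu v → ↓Xc v ≡ y)
    choose l x with ≡-dec _≟ᵇ_ l (↓L v) ×-dec ≡-dec _≟ᵇ_ x (↓Xu v)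
                  | finite-any? (vec-finite c) (λ y → P? ⟨ l , x , y ⟩)
    ... | yes (refl , refl) | _           = ↓Xc v , (λ _ → p) , λ _ → refl
    ... | no ¬start         | yes (y , q) = y , (λ _ → q) , λ start → ⊥-elim (¬start start)
    ... | no _              | no ¬good    = ↓Xc v , (λ good → ⊥-elim (¬good good)) , λ _ → refl

    σ : Strategy m u c
    σ (l , x) = proj₁ (choose l x)

    stays : ∀ ρ → IsExecution G v ρ → Compatible σ ρ → ∀ i → P (ρ i)
    stays ρ (start , _) compat zero = subst P (sym start) p
    stays ρ ex@(_ , steps) compat (suc i) =
      subst (λ y → P ⟨ ↓L (ρ (suc i)) , ↓Xu (ρ (suc i)) , y ⟩) (sym (compat (suc i)))
        (proj₁ (proj₂ (choose _ _))
          (subst (λ l → ∃[ y ] P ⟨ l , ↓Xu (ρ (suc i)) , y ⟩) (sym (steps i))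
            (closed (stays ρ ex compat i) (↓Xu (ρ (suc i))))))

    run : ℕ → Valuation m u c
    run zero    = v
    run (suc i) = ⟨ δ G (run i) , ↓Xu v , σ (δ G (run i) , ↓Xu v) ⟩

    run-compatible : Compatible σ run
    run-compatible zero    = proj₂ (proj₂ (choose _ _)) (refl , refl)
    run-compatible (suc i) = refl

module _ (G : Game m u c) (H : Game m′ u c) {R : Vec Bool m → Vec Bool m′ → Set} (R? : Decidable R)
         (simulates : ∀ {l k x y} → R l k → Winning proper G ⟨ l , x , y ⟩ →
                      err H ⟨ k , x , y ⟩ ≡ false × R (δ G ⟨ l , x , y ⟩) (δ H ⟨ k , x , y ⟩)) where

  -- The valuations of `H` related to winning ones of `G` form an invariant: inputs are copied, and
  -- `G` supplies each answer.
  simulation⇒winning : ∀ {l k x y} → R l k → Winning proper G ⟨ l , x , y ⟩ → Winning proper H ⟨ k , x , y ⟩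
  simulation⇒winning {l} Rlk win = invariant⇒winning H {P = Image} image?
    (λ (_ , R , win) → proj₁ (simulates R win))
    (λ (_ , R , win) x → let (y , win′) = winning-next G win x in y , _ , proj₂ (simulates R win) , win′)
    (l , Rlk , win)
    where
    Image : Valuation m′ u c → Set
    Image ⟨ k , x , y ⟩ = ∃[ l ] R l k × Winning proper G ⟨ l , x , y ⟩

    image? : ∀ v → Dec (Image v)
    image? ⟨ k , x , y ⟩ = finite-any? (vec-finite m) (λ l → R? l k ×-dec winning? proper G ⟨ l , x , y ⟩)

infix 9 _[err←_]

_[err←_] : Game m u c → BFun m u c → Game m u c
G [err← e ] = record { f = f G ; err = e }

-- Transitions are untouched, so the identity is a simulation.
err-change⇒winning : ∀ (G : Game m u c) e → (∀ {v} → Winning proper G v → e v ≡ false) →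
  ∀ {v} → Winning proper G v → Winning proper (G [err← e ]) v
err-change⇒winning G e h = simulation⇒winning G (G [err← e ]) {R = _≡_} (≡-dec _≟ᵇ_) (λ { refl win → h win , refl }) refl

-- Dependence on a subset of the latches.

RespectsLatches : Subset m → BFun m u c → Set
RespectsLatches A g = ∀ {l l′ x y} → l ↓ A ≡ l′ ↓ A → g ⟨ l , x , y ⟩ ≡ g ⟨ l′ , x , y ⟩

extend-↓ : (A : Subset m) (l : Vec Bool ∣ A ∣) → extend A l ↓ A ≡ l
extend-↓ []            []      = refl
extend-↓ (inside  ∷ A) (b ∷ l) = cong (b ∷_) (extend-↓ A l)
extend-↓ (outside ∷ A) l       = extend-↓ A l

member-∈ : (A : Subset m) (j : Fin ∣ A ∣) → member A j ∈ A
member-∈ (inside  ∷ A) zero    = here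
member-∈ (inside  ∷ A) (suc j) = there (member-∈ A j)
member-∈ (outside ∷ A) j       = there (member-∈ A j)

↓-tabulate : (A : Subset m) (h : Fin m → Bool) → tabulate h ↓ A ≡ tabulate (h ∘ member A)
↓-tabulate A h = tabulate-cong (λ j → lookup∘tabulate h (member A j))

-- Change `l` into `l′` one latch at a time: heads inside `A` already coincide, and a head outside
-- `A` may be flipped.
independent⇒respects : (A : Subset m) (g : Vec Bool m → Bool) →
  (∀ i → i ∉ A → ∀ l → g (l [ i ]≔ false) ≡ g (l [ i ]≔ true)) →
  ∀ {l l′} → l ↓ A ≡ l′ ↓ A → g l ≡ g l′
independent⇒respects []            g ind {[]}    {[]}     _  = refl
independent⇒respects (inside  ∷ A) g ind {b ∷ l} {b′ ∷ l′} eq with ∷-injective eq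
... | refl , eq′ =
  independent⇒respects A (g ∘ (b ∷_)) (λ i i∉A l → ind (suc i) (λ { (there i∈A) → i∉A i∈A }) (b ∷ l)) eq′
independent⇒respects (outside ∷ A) g ind {b ∷ l} {b′ ∷ l′} eq =
  trans (flip-head b b′)
    (independent⇒respects A (g ∘ (b′ ∷_)) (λ i i∉A l → ind (suc i) (λ { (there i∈A) → i∉A i∈A }) (b′ ∷ l)) eq)
  where
  flip-head : ∀ b b′ → g (b ∷ l) ≡ g (b′ ∷ l)
  flip-head false false = refl
  flip-head false true  = ind zero (λ ()) (false ∷ l)
  flip-head true  false = sym (ind zero (λ ()) (false ∷ l))
  flip-head true  true  = refl

-- Cones of influence.

module _ (G : Game m u c) (Φ : BFun m u c) where

  ∈cone⇒InCone : ∀ {l} → l ∈ cone G Φ → InCone G Φ (latch l)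
  ∈cone⇒InCone {l} l∈ = does-sound (inCone? G Φ (latch l))
    (trans (sym (lookup∘tabulate _ l)) ([]=⇒lookup l∈))

  InCone⇒∈cone : ∀ {l} → InCone G Φ (latch l) → l ∈ cone G Φ
  InCone⇒∈cone {l} i = lookup⇒[]= l _
    (trans (lookup∘tabulate _ l) (does-complete (inCone? G Φ (latch l)) i))

  cone-respects : RespectsLatches (cone G Φ) Φ
  cone-respects {x = x} {y} = independent⇒respects (cone G Φ) (λ l → Φ ⟨ l , x , y ⟩) λ i i∉ l →
    let
      ∃Φ≗Φ : ∀ v → ∃ᵛ (latch i) Φ v ≡ Φ v
      ∃Φ≗Φ v = decidable-stable (_ ≟ᵇ _) (λ ≢ → i∉ (InCone⇒∈cone (base (λ eq → ≢ (eq v)))))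

      -- The quantifier overwrites latch `i`, so the right side is the same for both values of `b`.
      Φ≡∨ : ∀ b → Φ ⟨ l [ i ]≔ b , x , y ⟩ ≡ Φ ⟨ l [ i ]≔ false , x , y ⟩ ∨ Φ ⟨ l [ i ]≔ true , x , y ⟩
      Φ≡∨ b = trans (sym (∃Φ≗Φ ⟨ l [ i ]≔ b , x , y ⟩))
        (cong₂ (λ k k′ → Φ ⟨ k , x , y ⟩ ∨ Φ ⟨ k′ , x , y ⟩) ([]≔-idempotent l i) ([]≔-idempotent l i))
    in trans (Φ≡∨ false) (sym (Φ≡∨ true))

  -- A latch outside the cone on which `f G k` depended would have entered it by `step`.
  cone-closed : ∀ {l} → l ∈ cone G Φ → RespectsLatches (cone G Φ) (f G l)
  cone-closed {k} k∈ {x = x} {y} = independent⇒respects (cone G Φ) (λ l → f G k ⟨ l , x , y ⟩) λ i i∉ l →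
    decidable-stable (_ ≟ᵇ _) λ ≢ → i∉ (InCone⇒∈cone (step (∈cone⇒InCone k∈) (⟨ l , x , y ⟩ , ≢)))

-- Subgames on a subset of the latches.

module _ (G : Game m u c) (A : Subset m) (g : Fin m → BFun m u c) (e : BFun m u c)
         (e-respects : RespectsLatches A e)
         (f-respects : ∀ {i} → i ∈ A → RespectsLatches A (f G i))
         (g≡f : ∀ {i} → i ∈ A → ∀ {v} → e v ≡ false → g i v ≡ f G i v) where

  private
    S : Game ∣ A ∣ u c
    S = subgame A g e

    subgame-err : ∀ {l x y} → err S ⟨ l ↓ A , x , y ⟩ ≡ e ⟨ l , x , y ⟩
    subgame-err {l} = e-respects (extend-↓ A (l ↓ A))

    subgame-δ : ∀ {l x y} → e ⟨ l , x , y ⟩ ≡ false → δ (G [err← e ]) ⟨ l , x , y ⟩ ↓ A ≡ δ S ⟨ l ↓ A , x , y ⟩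
    subgame-δ {l} {x} {y} safe = trans (↓-tabulate A (λ i → f G i ⟨ l , x , y ⟩)) (tabulate-cong λ j →
      -- `S` evaluates `g` at the extended valuation, which is safe because `l` is. There `g` is
      -- first replaced by `f G`, as only `f G` is known to respect `A`.
      sym (trans (g≡f (member-∈ A j) (trans (subgame-err {l}) safe))
                 (f-respects (member-∈ A j) (extend-↓ A (l ↓ A)))))

  -- The graph of restriction is a simulation both ways. Only winning, hence safe, valuations are
  -- matched, so `g` may be a cofactor.
  subgame-winning : ∀ {l x y} →
    Winning proper (subgame A g e) ⟨ l ↓ A , x , y ⟩ ⇔ Winning proper (G [err← e ]) ⟨ l , x , y ⟩
  subgame-winning = mk⇔
    (simulation⇒winning S (G [err← e ]) {R = λ k l → l ↓ A ≡ k} (λ _ _ → ≡-dec _≟ᵇ_ _ _)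
      (λ { {k = l} refl win → let safe = trans (sym (subgame-err {l})) (winning-safe S win) in
           safe , subgame-δ safe }) refl)
    (simulation⇒winning (G [err← e ]) S {R = λ l k → l ↓ A ≡ k} (λ _ _ → ≡-dec _≟ᵇ_ _ _)
      (λ { {l} refl win → let safe = winning-safe (G [err← e ]) win in
           trans (subgame-err {l}) safe , subgame-δ safe }) refl)

∧-true : ∀ {a b} → a ∧ b ≡ true → a ≡ true × b ≡ true
∧-true {true} {true} _ = refl , refl

∨-false : ∀ {a b} → a ∨ b ≡ false → a ≡ false × b ≡ false
∨-false {false} {false} _ = refl , refl

⋀-elim : (e : Fin n → BFun m u c) → ∀ {v} → ⋀ e v ≡ true → ∀ i → e i v ≡ true
⋀-elim e p zero    = proj₁ (∧-true p)
⋀-elim e p (suc i) = ⋀-elim (e ∘ suc) (proj₂ (∧-true p)) i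

⋀-intro : (e : Fin n → BFun m u c) → ∀ {v} → (∀ i → e i v ≡ true) → ⋀ e v ≡ true
⋀-intro {zero}  e p = refl
⋀-intro {suc n} e p = cong₂ _∧_ (p zero) (⋀-intro (e ∘ suc) (p ∘ suc))

⋁-elim : (e : Fin n → BFun m u c) → ∀ {v} → ⋁ e v ≡ false → ∀ i → e i v ≡ false
⋁-elim e p zero    = proj₁ (∨-false p)
⋁-elim e p (suc i) = ⋁-elim (e ∘ suc) (proj₂ (∨-false p)) i

⋁-intro : (e : Fin n → BFun m u c) → ∀ {v} → (∀ i → e i v ≡ false) → ⋁ e v ≡ false
⋁-intro {zero}  e p = refl
⋁-intro {suc n} e p = cong₂ _∨_ (p zero) (⋁-intro (e ∘ suc) (p ∘ suc))

cofactor-agrees : ∀ (f̂ f g : BFun m u c) → IsCofactor f̂ f g → ∀ {v} → g v ≡ true → f̂ v ≡ f v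
cofactor-agrees f̂ f g cof {v} gv = begin
  f̂ v           ≡⟨ ∧-identityʳ _ ⟨
  f̂ v ∧ true    ≡⟨ cong (f̂ v ∧_) gv ⟨
  f̂ v ∧ g v     ≡⟨ cof v ⟩
  f v ∧ g v     ≡⟨ cong (f v ∧_) gv ⟩
  f v ∧ true    ≡⟨ ∧-identityʳ _ ⟩
  f v           ∎
  where open ≡-Reasoning

-- Correctness of the algorithm.

module _ (r : Reading) (W≗proper : ∀ {m} (G : Game m u c) → W r G ≗ W proper G)
         (G : Game m u c) (e : Fin n → BFun m u c) (err≗⋁e : err G ≗ ⋁ e) where

  private
    L : BFun m u c
    L = Λ r G e

    w-winning : ∀ i v → w r G e i v ≡ true ⇔ Winning proper (G [err← e i ]) v
    w-winning i v = mk⇔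
      (λ wᵢv → to (does-sound (winning? proper Sᵢ v↓) (trans (sym (W≗proper Sᵢ v↓)) wᵢv)))
      (λ win → trans (W≗proper Sᵢ v↓) (does-complete (winning? proper Sᵢ v↓) (from win)))
      where
      A : Subset m
      A = cone G (e i)

      Sᵢ : Game ∣ A ∣ u c
      Sᵢ = subgame A (f G) (e i)

      v↓ : Valuation ∣ A ∣ u c
      v↓ = ⟨ ↓L v ↓ A , ↓Xu v , ↓Xc v ⟩

      open Equivalence (subgame-winning G A (f G) (e i)
        (cone-respects G (e i)) (cone-closed G (e i)) (λ _ _ → refl) {↓L v} {↓Xu v} {↓Xc v})

    -- A strategy avoiding `err G` avoids every `e i`. The converse can fail, since different `e i`
    -- may call for incompatible strategies; hence the final game.
    winning⇒Λ : ∀ {v} → Winning proper G v → L v ≡ true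
    winning⇒Λ {v} win = ⋀-intro (w r G e) {v} λ i → Equivalence.from (w-winning i v)
      (err-change⇒winning G (e i) (λ win′ → ⋁-elim e (trans (sym (err≗⋁e _)) (winning-safe G win′)) i) win)

    Λ⇒safe : ∀ {v} → L v ≡ true → err G v ≡ false
    Λ⇒safe {v} Λv = trans (err≗⋁e v) (⋁-intro e λ i →
      winning-safe (G [err← e i ]) (Equivalence.to (w-winning i v) (⋀-elim (w r G e) {v} Λv i)))

    -- Winning against `not ∘ L` means staying in `L`, which is safe for `G`; conversely, winning
    -- plays of `G` never leave `L`.
    ¬Λ-winning : ∀ {v} → Winning proper (G [err← not ∘ L ]) v ⇔ Winning proper G v
    ¬Λ-winning = mk⇔
      (err-change⇒winning (G [err← not ∘ L ]) (err G)
        (λ win → Λ⇒safe (not-injective (winning-safe (G [err← not ∘ L ]) win))))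
      (err-change⇒winning G (not ∘ L) (λ win → cong not (winning⇒Λ win)))

  comp₁-correct : (f′ : Fin m → BFun m u c) →
    (∀ l → l ∈ cone G (Λ r G e) → IsCofactor (f′ l) (f G l) (Λ r G e)) →
    comp₁ r G e f′ ≗ W r G
  comp₁-correct f′ cof v@(⟨ l , x , y ⟩) = begin
    comp₁ r G e f′ v                      ≡⟨ W≗proper S v↓ ⟩
    W proper S v↓                         ≡⟨ does-⇔ (subgame-winning G (cone G L) f′ (not ∘ L)
                                               (λ {l} {l′} eq → cong not (cone-respects G L {l} {l′} eq)) (cone-closed G L)
                                               -- Safety for the error `not ∘ L` is membership in
                                               -- `L`, where the cofactors are exact.
                                               (λ {k} k∈ ¬Λv → cofactor-agrees (f′ k) (f G k) L (cof k k∈) (not-injective ¬Λv)))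
                                               (winning? proper S v↓) (winning? proper (G [err← not ∘ L ]) v) ⟩
    W proper (G [err← not ∘ L ]) v        ≡⟨ does-⇔ ¬Λ-winning (winning? proper (G [err← not ∘ L ]) v) (winning? proper G v) ⟩
    W proper G v                          ≡⟨ W≗proper G v ⟨
    W r G v                               ∎
    where
    open ≡-Reasoning

    S : Game ∣ cone G L ∣ u c
    S = subgame (cone G L) f′ (not ∘ L)

    v↓ : Valuation ∣ cone G L ∣ u c
    v↓ = ⟨ l ↓ cone G L , x , y ⟩

theorem1 : ∀ {m u c n : ℕ} (r : Reading) (G : Game m u c) (e : Fin n → BFun m u c)
    → err G ≗ ⋁ e
    → (f′ : Fin m → BFun m u c)
    → (∀ l → l ∈ cone G (Λ r G e) → IsCofactor (f′ l) (f G l) (Λ r G e))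
    → comp₁ r G e f′ ≗ W r G
theorem1             proper  = comp₁-correct proper (λ _ _ → refl)
-- Here `winning?` is a `map′` of the proper decision, which leaves `does` unchanged.
theorem1 {c = zero}  literal = comp₁-correct literal (λ _ _ → refl)
-- On a nonempty control vector `winning?` answers `yes` for every game, so both sides compute to
-- `true`.
theorem1 {c = suc _} literal _ _ _ _ _ ⟨ _ , _ , _ ∷ _ ⟩ = refl
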